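{- Let $G$ be a digraph and $v\to w\in E(G)$. Then $v\to w$ is disimplicial in $G$ if and only if $(\mathrm{repr}(\mathrm{out}(v)),\mathrm{repr}(\mathrm{in}(w)))$ is a vertex of $\mathrm{Join}(\mathrm{Repr}(\mathrm{Split}(G)))$ and this vertex is transitive there.
   Context: A digraph is a finite vertex set $V$ with arc set $E\subseteq V\times V$. $N^+(v),N^-(v)$ denote out-/in-neighborhoods, $N(v)=N^+(v)\cup N^-(v)$, $d(v)=|N(v)|$. Source: $N^-(v)=\emptyset$; sink: $N^+(v)=\emptyset$; ST graph: every vertex is a source or a sink. An arc $v\to w$ is disimplicial if $x\to y$ is an arc for all $x\in N^-(w)$, $y\in N^+(v)$; a vertex $u$ is transitive if $x\to y$ is an arc for all $x\in N^-(u)$, $y\in N^+(u)$. $\mathrm{Split}(G)$ is the ST graph with a vertex $\mathrm{out}(v)$ for each non-sink $v$ of $G$ and a vertex $\mathrm{in}(w)$ for each non-source $w$ (all distinct), $\mathrm{out}(v)\to\mathrm{in}(w)$ an arc iff $v\to w\in E(G)$, no other arcs. In an ST graph $H$, vertices with equal $N(\cdot)$ are twins; twin blocks are the classes of this equivalence; $\mathrm{repr}$ picks one vertex of each block ($\mathrm{repr}(u)$ is the chosen vertex of $u$'s block), and $\mathrm{Repr}(H)$ is the subdigraph induced by the chosen vertices. In a digraph $H$, the thin neighbor $\theta(u)$ of $u$ is the unique $x\in N(u)$ with $d(x)<d(z)$ for all $z\in N(u)\setminus\{x\}$ (undefined if no such $x$); an arc $a\to b$ is thin if $\theta(a)=b$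 and $\theta(b)=a$. The thin arcs form a matching (no two share an endpoint). For a matching $M$ with endpoint set $V(M)$, $\mathrm{Join}(H,M)$ has a vertex $(u,u)$ for each $u\notin V(M)$ and a vertex $(a,b)$ for each $a\to b\in M$, with $(a,b)\to(x,y)$ an arc iff $a\to y\in E(H)$. $\mathrm{Join}(H)$ denotes $\mathrm{Join}(H,M)$ for $M$ the set of thin arcs of $H$. -}

module Defs where

open import Data.Empty using (⊥-elim-irr)
open import Data.Irrelevant using ([_])
open import Data.List.Base using (List; []; _∷_; _++_; map; filter; length; cartesianProduct; deduplicate)
open import Data.List.Membership.Propositional using () renaming (_∈_ to _∈ₗ_)
open import Data.List.Membership.Propositional.Properties
  using (∈-map⁺; ∈-++⁺ˡ; ∈-++⁺ʳ; ∈-cartesianProduct⁺; ∈-deduplicate⁺)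
open import Data.List.Relation.Unary.All as All using (All)
open import Data.List.Relation.Unary.Any using (here; there)
open import Data.List.Relation.Unary.Enumerates.Setoid using (IsEnumeration)
open import Data.List.Relation.Unary.Unique.Propositional using (Unique)
import Data.List.Relation.Unary.Unique.DecPropositional.Properties as Unique
open import Data.Nat.Base using (ℕ; _<_)
import Data.Nat.Properties as ℕ
open import Data.Product.Base using (∃; ∃-syntax; _×_; _,_)
import Data.Product.Properties as Product
open import Data.Refinement.Base using (Refinement-syntax; value; _,_)
import Data.Refinement.Properties as Refinement
open import Data.Sum.Base using (_⊎_; inj₁; inj₂)
import Data.Sum.Properties as Sum
open import Function.Base using (_∘_; _on_)
open import Level using (0ℓ)
open import Relation.Binary.Core using (Rel)
open import Relation.Binary.Definitions using (Decidable; DecidableEquality)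
open import Relation.Binary.PropositionalEquality using (_≡_; _≢_; refl; setoid)
open import Relation.Nullary using (¬_; Dec; yes; no; contradiction)
open import Relation.Nullary.Decidable using (map′; ¬?; _×-dec_; _⊎-dec_; _→-dec_)
import Relation.Unary as U
open U using (Pred; Empty; _∈_; _∉_; _∪_; _≐_)

------------------------------------------------------------------------
-- Finite types

record Finite (A : Set) : Set where
  infix 4 _≟_
  field
    _≟_      : DecidableEquality A
    elements : List A
    complete : IsEnumeration (setoid A) elements
    unique   : Unique elements

  all? : {P : Pred A 0ℓ} → U.Decidable P → Dec (∀ x → P x)
  all? P? = map′ (λ ps x → All.lookup ps (complete x)) (λ p → All.tabulate (λ {x} _ → p x))
                 (All.all? P? elements)

  any? : {P : Pred A 0ℓ} → U.Decidable P → Dec (∃ P)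
  any? {P} P? with all? (¬? ∘ P?)
  ... | yes none = no λ (x , p) → none x p
  ... | no ¬none = yes (search elements λ none → ¬none λ x → All.lookup none (complete x))
    where
    search : ∀ xs → ¬ All (¬_ ∘ P) xs → ∃ P
    search []       ¬none = contradiction All.[] ¬none
    search (x ∷ xs) ¬none with P? x
    ... | yes p = x , p
    ... | no ¬p = search xs λ none → ¬none (¬p All.∷ none)

module _ {A : Set} (_≟_ : DecidableEquality A) where

  enumerated : (xs : List A) → IsEnumeration (setoid A) xs → Finite A
  enumerated xs complete = record
    { _≟_      = _≟_
    ; elements = deduplicate _≟_ xs
    ; complete = λ x → ∈-deduplicate⁺ _≟_ (complete x)
    ; unique   = Unique.deduplicate-! _≟_ xs
    }

module _ {A B : Set} (finA : Finite A) (finB : Finite B) where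
  private
    module A = Finite finA
    module B = Finite finB

  ⊎-finite : Finite (A ⊎ B)
  ⊎-finite = enumerated (Sum.≡-dec A._≟_ B._≟_)
    (map inj₁ A.elements ++ map inj₂ B.elements)
    λ { (inj₁ a) → ∈-++⁺ˡ (∈-map⁺ inj₁ (A.complete a))
      ; (inj₂ b) → ∈-++⁺ʳ _ (∈-map⁺ inj₂ (B.complete b)) }

  ×-finite : Finite (A × B)
  ×-finite = enumerated (Product.≡-dec A._≟_ B._≟_)
    (cartesianProduct A.elements B.elements)
    λ (a , b) → ∈-cartesianProduct⁺ (A.complete a) (B.complete b)

module _ {A : Set} (finA : Finite A) {P : Pred A 0ℓ} (P? : U.Decidable P) where
  private
    module A = Finite finA

    restrict : List A → List [ x ∈ A ∣ P x ]
    restrict []       = []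
    restrict (x ∷ xs) with P? x
    ... | yes p = (x , [ p ]) ∷ restrict xs
    ... | no  _ = restrict xs

    ∈-restrict : ∀ {xs x} .(p : P x) → x ∈ₗ xs → (x , [ p ]) ∈ₗ restrict xs
    ∈-restrict {y ∷ xs} p x∈ with P? y | x∈
    ... | yes _ | here refl = here refl
    ... | yes _ | there x∈′ = there (∈-restrict p x∈′)
    ... | no ¬p | here refl = ⊥-elim-irr (¬p p)
    ... | no _  | there x∈′ = ∈-restrict p x∈′

  refinement-finite : Finite [ x ∈ A ∣ P x ]
  refinement-finite = enumerated (Refinement._≟_ A._≟_) (restrict A.elements)
    λ (x , [ p ]) → ∈-restrict p (A.complete x)

------------------------------------------------------------------------
-- Digraphs (loops and 2-cycles are allowed)

record Digraph : Set₁ where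
  infix 4 _⟶_ _⟶?_
  field
    V      : Set
    finite : Finite V
    _⟶_    : Rel V 0ℓ
    _⟶?_   : Decidable _⟶_

  open Finite finite public

  N⁺ N⁻ N : V → Pred V 0ℓ
  N⁺ v x = v ⟶ x
  N⁻ v x = x ⟶ v
  N  v   = N⁺ v ∪ N⁻ v

  N? : ∀ v → U.Decidable (N v)
  N? v x = (v ⟶? x) ⊎-dec (x ⟶? v)

  d : V → ℕ
  d v = length (filter (N? v) elements)

  Source Sink : Pred V 0ℓ
  Source v = Empty (N⁻ v)
  Sink   v = Empty (N⁺ v)

  source? : U.Decidable Source
  source? v = all? λ x → ¬? (x ⟶? v)

  sink? : U.Decidable Sink
  sink? v = all? λ x → ¬? (v ⟶? x)

  tail-nonSink : ∀ {v w} → v ⟶ w → ¬ Sink v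
  tail-nonSink {w = w} v⟶w sink = sink w v⟶w

  head-nonSource : ∀ {v w} → v ⟶ w → ¬ Source w
  head-nonSource {v = v} v⟶w source = source v v⟶w

  DisimplicialArc : Rel V 0ℓ
  DisimplicialArc v w = v ⟶ w × (∀ {x y} → x ∈ N⁻ w → y ∈ N⁺ v → x ⟶ y)

  TransitiveVertex : Pred V 0ℓ
  TransitiveVertex u = ∀ {x y} → x ∈ N⁻ u → y ∈ N⁺ u → x ⟶ y

  Twins : Rel V 0ℓ
  Twins u v = N u ≐ N v

  -- The graph of the partial function θ: at most one x satisfies
  -- ThinNeighbor u x, because the inequality is strict.
  ThinNeighbor : V → Pred V 0ℓ
  ThinNeighbor u x = x ∈ N u × (∀ z → z ∈ N u → z ≢ x → d x < d z)

  thinNeighbor? : ∀ u → U.Decidable (ThinNeighbor u)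
  thinNeighbor? u x =
    N? u x ×-dec all? λ z → N? u z →-dec ¬? (z ≟ x) →-dec d x ℕ.<? d z

  ThinArc : Rel V 0ℓ
  ThinArc a b = a ⟶ b × ThinNeighbor a b × ThinNeighbor b a

  thinArc? : Decidable ThinArc
  thinArc? a b = (a ⟶? b) ×-dec thinNeighbor? a b ×-dec thinNeighbor? b a

open Digraph using (V)

------------------------------------------------------------------------
-- Split

module _ (G : Digraph) where
  open Digraph G hiding (V)

  SplitVertex : Set
  SplitVertex = [ v ∈ V G ∣ ¬ Sink v ] ⊎ [ w ∈ V G ∣ ¬ Source w ]

  data SplitArc : Rel SplitVertex 0ℓ where
    arc : ∀ {v w} → value v ⟶ value w → SplitArc (inj₁ v) (inj₂ w)

  Split : Digraph
  Split = record
    { V      = SplitVertex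
    ; finite = ⊎-finite (refinement-finite finite (¬? ∘ sink?))
                        (refinement-finite finite (¬? ∘ source?))
    ; _⟶_    = SplitArc
    ; _⟶?_   = λ where
        (inj₁ v) (inj₂ w) → map′ arc (λ { (arc e) → e }) (value v ⟶? value w)
        (inj₁ _) (inj₁ _) → no λ ()
        (inj₂ _) _        → no λ ()
    }

  out : (v : V G) → .(¬ Sink v) → V Split
  out v p = inj₁ (v , [ p ])

  inn : (w : V G) → .(¬ Source w) → V Split
  inn w p = inj₂ (w , [ p ])

------------------------------------------------------------------------
-- Induced subdigraphs and Repr

Induced : (H : Digraph) {P : Pred (V H) 0ℓ} → U.Decidable P → Digraph
Induced H {P} P? = record
  { V      = [ u ∈ V H ∣ P u ]
  ; finite = refinement-finite finite P?
  ; _⟶_    = _⟶_ on value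
  ; _⟶?_   = λ u v → value u ⟶? value v
  }
  where open Digraph H hiding (V)

-- Blocks are the classes of Twins; this is intended for ST graphs H.
record BlockRepr (H : Digraph) : Set where
  open Digraph H using (Twins; _≟_; any?)
  field
    repr       : V H → V H
    repr-block : ∀ u → Twins u (repr u)
    repr-cong  : ∀ {u v} → Twins u v → repr u ≡ repr v

  Chosen : Pred (V H) 0ℓ
  Chosen x = ∃[ u ] repr u ≡ x

  chosen? : U.Decidable Chosen
  chosen? x = any? λ u → repr u ≟ x

  Repr : Digraph
  Repr = Induced H chosen?

  -- repr with its codomain restricted to the vertices of Repr.
  reprᵛ : V H → V Repr
  reprᵛ u = repr u , [ u , refl ]

------------------------------------------------------------------------
-- Join

-- M is an arbitrary decidable set of pairs here; the construction is
-- intended for M a matching of H.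
module _ (H : Digraph) {M : Rel (V H) 0ℓ} (M? : Decidable M) where
  open Digraph H hiding (V)

  Endpoint : Pred (V H) 0ℓ
  Endpoint u = ∃[ x ] (M u x ⊎ M x u)

  endpoint? : U.Decidable Endpoint
  endpoint? u = any? λ x → M? u x ⊎-dec M? x u

  JoinVertex : Pred (V H × V H) 0ℓ
  JoinVertex (a , b) = (a ≡ b × a ∉ Endpoint) ⊎ M a b

  joinVertex? : U.Decidable JoinVertex
  joinVertex? (a , b) = (a ≟ b ×-dec ¬? (endpoint? a)) ⊎-dec M? a b

  JoinAlong : Digraph
  JoinAlong = record
    { V      = [ p ∈ V H × V H ∣ JoinVertex p ]
    ; finite = refinement-finite (×-finite finite finite) joinVertex?
    ; _⟶_    = λ { ((a , _) , _) ((_ , y) , _) → a ⟶ y }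
    ; _⟶?_   = λ { ((a , _) , _) ((_ , y) , _) → a ⟶? y }
    }

Join : Digraph → Digraph
Join H = JoinAlong H (Digraph.thinArc? H)

IsJoinVertex : (H : Digraph) → Pred (V H × V H) 0ℓ
IsJoinVertex H = JoinVertex H (Digraph.thinArc? H)

{-# OPTIONS --safe #-}

-- In a twin-free ST graph, let a ⟶ b be disimplicial. Every z with a ⟶ z satisfies N b ⊆ N z,
-- so twin-freeness forces d b < d z unless z is b; hence b = θ(a), and dually a = θ(b): the arc is
-- thin, i.e. (a , b) is a vertex of the join. Every in-neighbor of b is the first component of a
-- join vertex and every out-neighbor of a the second component of one, so transitivity of (a , b)
-- in the join says exactly that a ⟶ b is disimplicial. Finally, Repr of an ST graph is a twin-free
-- ST graph, and both Split and Repr preserve and reflect disimplicial arcs.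
module Submission where

open import Defs
open import Data.Irrelevant using ([_])
open import Data.Product.Base using (Σ-syntax; _×_; _,_)
open import Data.Refinement.Base using (_,_)
open import Function.Bundles using (_⇔_)
open Digraph using (DisimplicialArc; TransitiveVertex; tail-nonSink; head-nonSource)
open BlockRepr using (Repr; reprᵛ)

open import Data.List.Membership.Propositional using () renaming (_∈_ to _∈ₗ_)
open import Data.List.Membership.Propositional.Properties using (∈-filter⁺; ∈-filter⁻)
open import Data.List.Relation.Binary.Pointwise using (Pointwise-≡⇒≡)
open import Data.List.Relation.Binary.Sublist.Propositional using (⊆-refl)
open import Data.List.Relation.Binary.Sublist.Propositional.Properties
  using (filter⁺; length-mono-≤; to-≋)
open import Data.Nat.Base using (_<_)
open import Data.Nat.Properties using (≤∧≢⇒<)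
open import Data.Product.Base using (∃-syntax; proj₂)
open import Data.Refinement.Base using (value)
open import Data.Refinement.Properties using (value-injective)
open import Data.Sum.Base using (_⊎_; inj₁; inj₂; swap)
open import Function.Base using (_∘_)
open import Function.Bundles using (mk⇔)
open import Function.Construct.Composition using (_⇔-∘_)
open import Relation.Binary.PropositionalEquality
  using (_≡_; _≢_; refl; sym; trans; subst)
open import Relation.Nullary using (¬_; yes; no; contradiction)
open import Relation.Nullary.Decidable using (recompute)
open import Relation.Unary using (_∈_; _⊆_)
open import Relation.Unary.Properties using (≐-sym)

module _ (H : Digraph) where
  open Digraph H

  ST TwinFree : Set
  ST       = ∀ v → Source v ⊎ Sink v
  TwinFree = ∀ {u v} → Twins u v → u ≡ v

module _ {H : Digraph} where
  open Digraph H

  -- Both degrees are lengths of filters of the one list `elements`, so the inclusion makes the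
  -- first filtered list a sublist of the second. A sublist of the same length is the whole list,
  -- which would make `u` and `v` twins.
  N⊆⇒d< : ∀ {u v} → N u ⊆ N v → ¬ Twins u v → d u < d v
  N⊆⇒d< {u} {v} Nu⊆Nv ¬twins = ≤∧≢⇒< (length-mono-≤ sublist) λ du≡dv →
    ¬twins (Nu⊆Nv , λ {x} x∈Nv → proj₂ (∈-filter⁻ (N? u) {xs = elements}
      (subst (x ∈ₗ_) (sym (Pointwise-≡⇒≡ (to-≋ du≡dv sublist)))
        (∈-filter⁺ (N? v) (complete x) x∈Nv))))
    where
    sublist = filter⁺ (N? u) (N? v) (λ { refl → Nu⊆Nv }) (⊆-refl {x = elements})

module ST-Properties {H : Digraph} (st : ST H) where
  open Digraph H hiding (DisimplicialArc; TransitiveVertex)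

  no-path : ∀ {x y z} → x ⟶ y → ¬ (y ⟶ z)
  no-path {x} {y} {z} x⟶y y⟶z with st y
  ... | inj₁ source = source x x⟶y
  ... | inj₂ sink   = sink z y⟶z

  -- `N` forgets the direction of arcs, and `no-path` restores it: the wrong orientation would give
  -- `u` both an in-arc and an out-arc.
  twins-⟶ʳ : ∀ {u v v′} → Twins v v′ → u ⟶ v → u ⟶ v′
  twins-⟶ʳ (Nv⊆Nv′ , _) u⟶v with Nv⊆Nv′ (inj₂ u⟶v)
  ... | inj₁ v′⟶u = contradiction u⟶v (no-path v′⟶u)
  ... | inj₂ u⟶v′ = u⟶v′

  twins-⟶ˡ : ∀ {u u′ v} → Twins u u′ → u ⟶ v → u′ ⟶ v
  twins-⟶ˡ (Nu⊆Nu′ , _) u⟶v with Nu⊆Nu′ (inj₁ u⟶v)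
  ... | inj₁ u′⟶v = u′⟶v
  ... | inj₂ v⟶u′ = contradiction v⟶u′ (no-path u⟶v)

  disimplicial⇒thin : TwinFree H → ∀ {a b} → DisimplicialArc H a b → ThinArc a b
  disimplicial⇒thin twinFree {a} {b} (a⟶b , dis) =
    a⟶b , (inj₁ a⟶b , θa) , (inj₂ a⟶b , θb)
    where
    θa : ∀ z → z ∈ N a → z ≢ b → d b < d z
    θa z (inj₂ z⟶a) _   = contradiction a⟶b (no-path z⟶a)
    θa z (inj₁ a⟶z) z≢b = N⊆⇒d< {H} Nb⊆Nz (z≢b ∘ sym ∘ twinFree)
      where
      Nb⊆Nz : N b ⊆ N z
      Nb⊆Nz (inj₁ b⟶x) = contradiction b⟶x (no-path a⟶b)
      Nb⊆Nz (inj₂ x⟶b) = inj₂ (dis x⟶b a⟶z)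

    θb : ∀ z → z ∈ N b → z ≢ a → d a < d z
    θb z (inj₁ b⟶z) _   = contradiction b⟶z (no-path a⟶b)
    θb z (inj₂ z⟶b) z≢a = N⊆⇒d< {H} Na⊆Nz (z≢a ∘ sym ∘ twinFree)
      where
      Na⊆Nz : N a ⊆ N z
      Na⊆Nz (inj₁ a⟶y) = inj₁ (dis z⟶b a⟶y)
      Na⊆Nz (inj₂ y⟶a) = contradiction a⟶b (no-path y⟶a)

  -- If `x` lies on a thin arc, it must be the tail, since it already has an out-arc; otherwise it
  -- is paired with itself.
  nonSink⇒join-fst : ∀ {x z} → x ⟶ z → ∃[ x′ ] IsJoinVertex H (x , x′)
  nonSink⇒join-fst {x} x⟶z with endpoint? H thinArc? x
  ... | no  ¬end                    = x , inj₁ (refl , ¬end)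
  ... | yes (x′ , inj₁ thin)        = x′ , inj₂ thin
  ... | yes (x′ , inj₂ (x′⟶x , _)) = contradiction x⟶z (no-path x′⟶x)

  nonSource⇒join-snd : ∀ {y z} → z ⟶ y → ∃[ y′ ] IsJoinVertex H (y′ , y)
  nonSource⇒join-snd {y} z⟶y with endpoint? H thinArc? y
  ... | no  ¬end                    = y , inj₁ (refl , ¬end)
  ... | yes (y′ , inj₁ (y⟶y′ , _)) = contradiction y⟶y′ (no-path z⟶y)
  ... | yes (y′ , inj₂ thin)        = y′ , inj₂ thin

  disimplicial⇔transitive : TwinFree H → ∀ {a b} → a ⟶ b →
    DisimplicialArc H a b ⇔
    (Σ[ p ∈ IsJoinVertex H (a , b) ] TransitiveVertex (Join H) ((a , b) , [ p ]))
  disimplicial⇔transitive twinFree a⟶b = mk⇔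
    -- A join arc inspects only the first component of its tail and the second component of its
    -- head, so `dis` itself is the proof of transitivity.
    (λ (_ , dis) → inj₂ (disimplicial⇒thin twinFree (a⟶b , dis)) , dis)
    λ (_ , transitive) → a⟶b , λ {x} {y} x⟶b a⟶y →
      let x′ , p = nonSink⇒join-fst x⟶b
          y′ , q = nonSource⇒join-snd a⟶y
      in transitive {(x , x′) , [ p ]} {(y′ , y) , [ q ]} x⟶b a⟶y

module Repr-Properties {H : Digraph} (R : BlockRepr H) where
  open Digraph H hiding (DisimplicialArc; TransitiveVertex)
  open BlockRepr R hiding (Repr; reprᵛ)

  Repr-ST : ST H → ST (Repr R)
  Repr-ST st (u , _) with st u
  ... | inj₁ source = inj₁ (source ∘ value)
  ... | inj₂ sink   = inj₂ (sink ∘ value)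

  repr-idem : ∀ u → repr (repr u) ≡ repr u
  repr-idem u = sym (repr-cong (repr-block u))

  -- The preimage of `u` under `repr` is stored irrelevantly, so the equation has to be recovered
  -- from decidable equality.
  repr-chosen : (u : Digraph.V (Repr R)) → repr (value u) ≡ value u
  repr-chosen (u , [ c ]) = recompute (repr u ≟ u) (fixed c)
    where
    fixed : Chosen u → repr u ≡ u
    fixed (v , refl) = repr-idem v

  Repr-twins : ∀ u v → Digraph.Twins (Repr R) u v → Twins (value u) (value v)
  Repr-twins u v (Nu⊆Nv , Nv⊆Nu) =
    lift u v (λ {x} → Nu⊆Nv {x}) , lift v u (λ {x} → Nv⊆Nu {x})
    where
    lift : ∀ u v → Digraph.N (Repr R) u ⊆ Digraph.N (Repr R) v → N (value u) ⊆ N (value v)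
    lift _ _ Nu⊆Nv {x} x∈Nu =
      -- `x` need not be chosen, so the argument passes through its twin `repr x`. Each `swap`
      -- exchanges the two ends of a neighbor relation, so that twinness applies on the side of `x`.
      let to , from = repr-block x
      in swap (from (swap (Nu⊆Nv {reprᵛ R x} (swap (to (swap x∈Nu))))))

  -- Chosen vertices are fixed by `repr`, which is constant on blocks.
  Repr-twinFree : TwinFree (Repr R)
  Repr-twinFree {u} {v} twins = value-injective
    (trans (sym (repr-chosen u)) (trans (repr-cong (Repr-twins u v twins)) (repr-chosen v)))

  module _ (st : ST H) where
    open ST-Properties {H} st

    repr-⟶ : ∀ {x y} → x ⟶ y → repr x ⟶ repr y
    repr-⟶ {x} {y} = twins-⟶ˡ (repr-block x) ∘ twins-⟶ʳ (repr-block y)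

    repr-⟶⁻ : ∀ {x y} → repr x ⟶ repr y → x ⟶ y
    repr-⟶⁻ {x} {y} = twins-⟶ˡ (≐-sym (repr-block x)) ∘ twins-⟶ʳ (≐-sym (repr-block y))

    Repr-disimplicial : ∀ {u v} →
      DisimplicialArc H u v ⇔ DisimplicialArc (Repr R) (reprᵛ R u) (reprᵛ R v)
    Repr-disimplicial {u} {v} = mk⇔
      -- Here `x` and `y` are already vertices of `H`; only `repr u` and `repr v` are traded back
      -- for `u` and `v`.
      (λ (u⟶v , dis) → repr-⟶ u⟶v , λ x⟶v u⟶y →
        dis (twins-⟶ʳ (≐-sym (repr-block v)) x⟶v) (twins-⟶ˡ (≐-sym (repr-block u)) u⟶y))
      -- Arbitrary `x` and `y` are moved to their representatives, and the resulting arc is pulled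
      -- back.
      (λ (u⟶v , dis) → repr-⟶⁻ u⟶v , λ {x} {y} x⟶v u⟶y →
        repr-⟶⁻ (dis {reprᵛ R x} {reprᵛ R y} (repr-⟶ x⟶v) (repr-⟶ u⟶y)))

module _ (G : Digraph) where
  open Digraph G using (_⟶_)

  Split-ST : ST (Split G)
  Split-ST (inj₁ _) = inj₁ λ _ ()
  Split-ST (inj₂ _) = inj₂ λ _ ()

  Split-disimplicial : ∀ {v w} (e : v ⟶ w) → DisimplicialArc G v w ⇔
    DisimplicialArc (Split G) (out G v (tail-nonSink G e)) (inn G w (head-nonSource G e))
  Split-disimplicial e = mk⇔
    (λ (_ , dis) → arc e , λ { (arc x⟶w) (arc v⟶y) → arc (dis x⟶w v⟶y) })
    λ (_ , dis) → e , λ x⟶w v⟶y →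
      -- The arcs into `w` and out of `v` themselves certify that the required out- and in-vertices
      -- exist in the split.
      arc⁻ (dis {out G _ (tail-nonSink G x⟶w)} {inn G _ (head-nonSource G v⟶y)}
                (arc x⟶w) (arc v⟶y))
    where
    arc⁻ : ∀ {x y} → SplitArc G (inj₁ x) (inj₂ y) → value x ⟶ value y
    arc⁻ (arc x⟶y) = x⟶y

theorem9 : (G : Digraph) (R : BlockRepr (Split G)) {v w : Digraph.V G}
  (e : Digraph._⟶_ G v w) →
  let a = reprᵛ R (out G v (tail-nonSink G e))
      b = reprᵛ R (inn G w (head-nonSource G e))
      H = Repr R
  in DisimplicialArc G v w ⇔
     (Σ[ p ∈ IsJoinVertex H (a , b) ] TransitiveVertex (Join H) ((a , b) , [ p ]))
theorem9 G R e =
  ST-Properties.disimplicial⇔transitive {Repr R} (Repr-ST st) Repr-twinFree ab ⇔-∘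
  (Repr-disimplicial st ⇔-∘ Split-disimplicial G e)
  where
  open Repr-Properties R
  st = Split-ST G
  ab = repr-⟶ st (arc e)
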